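{- For every process $P$ the following are equivalent: (1) there are $\Gamma,\Delta,x,A$ such that $\Gamma;\Delta\vdash_{\mathcal I}P::x:A$ is derivable in $\pi\mathsf{ILL}$; (2) there are $\Gamma,\Delta,\Lambda$ such that $\Gamma;\Delta\vdash P::\Lambda$ has a derivation in $\pi\mathsf{ULL}$ in which every sequent has $r$-degree $1$; (3) there are $\Gamma,\Delta,\Lambda$ such that $\Gamma;\Delta\vdash_{\curvearrowright}P::\Lambda$ has a derivation in $\pi\mathsf{ULL}_{\curvearrowright}$ that uses neither rule ($\curvearrowleft$) nor rule ($\curvearrowright$).
   Context: **Types.** $A,B::=\mathbf 1\mid\bot\mid A\otimes B\mid A\multimap B\mid \oplus\{i:A_i\}_{i\in I}\mid \&\{i:A_i\}_{i\in I}\mid {!}A\mid {?}A$. **Duality**: $\mathbf 1^\perp=\bot$, $\bot^\perp=\mathbf 1$, $(A\otimes B)^\perp=A\multimap B^\perp$, $(A\multimap B)^\perp=A\otimes B^\perp$, $(\oplus\{i:A_i\})^\perp=\&\{i:A_i^\perp\}$, $(\&\{i:A_i\})^\perp=\oplus\{i:A_i^\perp\}$, $({!}A)^\perp={?}A^\perp$, $({?}A)^\perp={!}A^\perp$; $A⅋B:=A^\perp\multimap B$. **Processes.** $P,Q::=\mathbf 0\mid \nu x\,P\mid P|Q\mid x[y].P\mid x(y).P\mid x\triangleleft \ell.P\mid x\triangleright\{i:P_i\}_{i\in I}\mid {!}x(y).P\mid [x\leftrightarrow y]\mid x[\,].P\mid x(\,).P$ (send, receive, select, branch, replicated receive, forwarder,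 empty send, empty receive). $y$ is bound in $\nu y\,P$, $x(y).P$, ${!}x(y).P$; processes up to $\alpha$-renaming; $P\{y/x\}$ capture-avoiding substitution. **Type system $\pi\mathsf{ULL}$.** Judgments $\Gamma;\Delta\vdash P::\Lambda$ ($\Gamma$ unrestricted, $\Delta,\Lambda$ linear; finite sets of $x:A$ with distinct names; comma = disjoint union). Rules ($\Gamma$ shared); those marked $(\ast)$ are the starred rules: (idR)$^\ast$ $\Gamma;x:A\vdash[x\leftrightarrow y]::y:A$. (idL) $\Gamma;x:A,y:A^\perp\vdash[x\leftrightarrow y]::\emptyset$. (1R)$^\ast$ $\Gamma;\emptyset\vdash x[\,].\mathbf 0::x:\mathbf 1$. (1L)$^\ast$ $\Gamma;\Delta\vdash P::\Lambda\Rightarrow\Gamma;\Delta,x:\mathbf 1\vdash x(\,).P::\Lambda$. (⊥R) $\Gamma;\Delta\vdash P::\Lambda\Rightarrow\Gamma;\Delta\vdash x(\,).P::\Lambda,x:\bot$. (⊥L) $\Gamma;x:\bot\vdash x[\,].\mathbf 0::\emptyset$. (⊗R)$^\ast$ $\Gamma;\Delta\vdash P::\Lambda,y:A$, $\Gamma;\Delta'\vdash Q::\Lambda',x:B\Rightarrow\Gamma;\Delta,\Delta'\vdash\nu y\,x[y].(P|Q)::\Lambda,\Lambda',x:A\otimes B$. (⊗L)$^\ast$ $\Gamma;\Delta,y:A,x:B\vdash P::\Lambda\Rightarrow\Gamma;\Delta,x:A\otimes B\vdash x(y).P::\Lambda$. (⅋R) $\Gamma;\Delta\vdash P::\Lambda,y:A,x:B\Rightarrow\Gamma;\Delta\vdash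 x(y).P::\Lambda,x:A⅋B$. (⅋L) $\Gamma;\Delta,y:A\vdash P::\Lambda$, $\Gamma;\Delta',x:B\vdash Q::\Lambda'\Rightarrow\Gamma;\Delta,\Delta',x:A⅋B\vdash\nu y\,x[y].(P|Q)::\Lambda,\Lambda'$. (⊸R)$^\ast$ $\Gamma;\Delta,y:A\vdash P::\Lambda,x:B\Rightarrow\Gamma;\Delta\vdash x(y).P::\Lambda,x:A\multimap B$. (⊸L)$^\ast$ $\Gamma;\Delta\vdash P::\Lambda,y:A$, $\Gamma;\Delta',x:B\vdash Q::\Lambda'\Rightarrow\Gamma;\Delta,\Delta',x:A\multimap B\vdash\nu y\,x[y].(P|Q)::\Lambda,\Lambda'$. (⊕R)$^\ast$ $\Gamma;\Delta\vdash P::\Lambda,x:A_j$, $j\in I\Rightarrow\Gamma;\Delta\vdash x\triangleleft j.P::\Lambda,x:\oplus\{i:A_i\}_{i\in I}$. (⊕L)$^\ast$ $\forall i\in I.\ \Gamma;\Delta,x:A_i\vdash P_i::\Lambda\Rightarrow\Gamma;\Delta,x:\oplus\{i:A_i\}_{i\in I}\vdash x\triangleright\{i:P_i\}_{i\in I}::\Lambda$. (&R)$^\ast$ $\forall i\in I.\ \Gamma;\Delta\vdash P_i::\Lambda,x:A_i\Rightarrow\Gamma;\Delta\vdash x\triangleright\{i:P_i\}_{i\in I}::\Lambda,x:\&\{i:A_i\}_{i\in I}$. (&L)$^\ast$ $\Gamma;\Delta,x:A_j\vdash P::\Lambda$, $j\in I\Rightarrow\Gamma;\Delta,x:\&\{i:A_i\}_{i\in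 I}\vdash x\triangleleft j.P::\Lambda$. (copyR) $\Gamma,u:A;\Delta\vdash P::\Lambda,x:A^\perp\Rightarrow\Gamma,u:A;\Delta\vdash\nu x\,u[x].P::\Lambda$. (copyL)$^\ast$ $\Gamma,u:A;\Delta,x:A\vdash P::\Lambda\Rightarrow\Gamma,u:A;\Delta\vdash\nu x\,u[x].P::\Lambda$. (!R)$^\ast$ $\Gamma;\emptyset\vdash P::y:A\Rightarrow\Gamma;\emptyset\vdash{!}x(y).P::x:{!}A$. (!L)$^\ast$ $\Gamma,u:A;\Delta\vdash P::\Lambda\Rightarrow\Gamma;\Delta,x:{!}A\vdash P\{x/u\}::\Lambda$. (?R) $\Gamma,u:A;\Delta\vdash P::\Lambda\Rightarrow\Gamma;\Delta\vdash P\{x/u\}::\Lambda,x:{?}A^\perp$. (?L) $\Gamma;y:A\vdash P::\emptyset\Rightarrow\Gamma;x:{?}A\vdash{!}x(y).P::\emptyset$. (cutRL)$^\ast$ $\Gamma;\Delta\vdash P::\Lambda,x:A$, $\Gamma;\Delta',x:A\vdash Q::\Lambda'\Rightarrow\Gamma;\Delta,\Delta'\vdash\nu x(P|Q)::\Lambda,\Lambda'$; (cutLR)$^\ast$ premises $\Gamma;\Delta,x:A\vdash P::\Lambda$, $\Gamma;\Delta'\vdash Q::\Lambda',x:A$; (cutRR) premises $\Gamma;\Delta\vdash P::\Lambda,x:A$, $\Gamma;\Delta'\vdash Q::\Lambda',x:A^\perp$; (cutLL) premises $\Gamma;\Delta,x:A\vdash P::\Lambda$, $\Gamma;\Delta',x:A^\perp\vdash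 Q::\Lambda'$ (same conclusion). (cut!R)$^\ast$ $\Gamma,u:A;\Delta\vdash P::\Lambda$, $\Gamma;\emptyset\vdash Q::x:A\Rightarrow\Gamma;\Delta\vdash\nu u(P|{!}u(x).Q)::\Lambda$. (cut!L)$^\ast$ $\Gamma;\emptyset\vdash P::x:A$, $\Gamma,u:A;\Delta\vdash Q::\Lambda\Rightarrow\Gamma;\Delta\vdash\nu u({!}u(x).P|Q)::\Lambda$. (cut?R) $\Gamma,u:A;\Delta\vdash P::\Lambda$, $\Gamma;x:A^\perp\vdash Q::\emptyset\Rightarrow\Gamma;\Delta\vdash\nu u(P|{!}u(x).Q)::\Lambda$. (cut?L) $\Gamma;x:A^\perp\vdash P::\emptyset$, $\Gamma,u:A;\Delta\vdash Q::\Lambda\Rightarrow\Gamma;\Delta\vdash\nu u({!}u(x).P|Q)::\Lambda$. The **$r$-degree** of a $\pi\mathsf{ULL}$ sequent $\Gamma;\Delta\vdash P::\Lambda$ is $|\Lambda|$, the number of assignments in $\Lambda$. **$\pi\mathsf{ULL}_{\curvearrowright}$**: judgments $\Gamma;\Delta\vdash_{\curvearrowright}P::\Lambda$; rules are exactly the starred $(\ast)$ rules above plus ($\curvearrowleft$) $\Gamma;\Delta\vdash_{\curvearrowright}P::\Lambda,x:A\Rightarrow\Gamma;\Delta,x:A^\perp\vdash_{\curvearrowright}P::\Lambda$ and ($\curvearrowright$) $\Gamma;\Delta,x:A\vdash_{\curvearrowright}P::\Lambda\Rightarrow\Gamma;\Delta\vdash_{\curvearrowright}P::\Lambda,x:A^\perp$.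 **$\pi\mathsf{ILL}$**: types $A,B::=\mathbf 1\mid A\otimes B\mid A\multimap B\mid\oplus\{i:A_i\}_{i\in I}\mid\&\{i:A_i\}_{i\in I}\mid{!}A$; judgments $\Gamma;\Delta\vdash_{\mathcal I}P::z:C$ (exactly one assignment on the right). Rules: (id) $\Gamma;x:A\vdash_{\mathcal I}[x\leftrightarrow y]::y:A$. (1R) $\Gamma;\emptyset\vdash_{\mathcal I}x[\,].\mathbf 0::x:\mathbf 1$. (1L) $\Gamma;\Delta\vdash_{\mathcal I}P::z:C\Rightarrow\Gamma;\Delta,x:\mathbf 1\vdash_{\mathcal I}x(\,).P::z:C$. (⊗R) $\Gamma;\Delta\vdash_{\mathcal I}P::y:A$, $\Gamma;\Delta'\vdash_{\mathcal I}Q::x:B\Rightarrow\Gamma;\Delta,\Delta'\vdash_{\mathcal I}\nu y\,x[y].(P|Q)::x:A\otimes B$. (⊗L) $\Gamma;\Delta,y:A,x:B\vdash_{\mathcal I}P::z:C\Rightarrow\Gamma;\Delta,x:A\otimes B\vdash_{\mathcal I}x(y).P::z:C$. (⊸R) $\Gamma;\Delta,y:A\vdash_{\mathcal I}P::x:B\Rightarrow\Gamma;\Delta\vdash_{\mathcal I}x(y).P::x:A\multimap B$. (⊸L) $\Gamma;\Delta\vdash_{\mathcal I}P::y:A$, $\Gamma;\Delta',x:B\vdash_{\mathcal I}Q::z:C\Rightarrow\Gamma;\Delta,\Delta',x:A\multimap B\vdash_{\mathcal I}\nu y\,x[y].(P|Q)::z:C$. (⊕R) $\Gamma;\Delta\vdash_{\mathcal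 I}P::x:A_j$, $j\in I\Rightarrow\Gamma;\Delta\vdash_{\mathcal I}x\triangleleft j.P::x:\oplus\{i:A_i\}_{i\in I}$. (⊕L) $\forall i.\ \Gamma;\Delta,x:A_i\vdash_{\mathcal I}P_i::z:C\Rightarrow\Gamma;\Delta,x:\oplus\{i:A_i\}_{i\in I}\vdash_{\mathcal I}x\triangleright\{i:P_i\}_{i\in I}::z:C$. (&R) $\forall i.\ \Gamma;\Delta\vdash_{\mathcal I}P_i::x:A_i\Rightarrow\Gamma;\Delta\vdash_{\mathcal I}x\triangleright\{i:P_i\}_{i\in I}::x:\&\{i:A_i\}_{i\in I}$. (&L) $\Gamma;\Delta,x:A_j\vdash_{\mathcal I}P::z:C$, $j\in I\Rightarrow\Gamma;\Delta,x:\&\{i:A_i\}_{i\in I}\vdash_{\mathcal I}x\triangleleft j.P::z:C$. (copy) $\Gamma,u:A;\Delta,x:A\vdash_{\mathcal I}P::z:C\Rightarrow\Gamma,u:A;\Delta\vdash_{\mathcal I}\nu x\,u[x].P::z:C$. (!R) $\Gamma;\emptyset\vdash_{\mathcal I}P::y:A\Rightarrow\Gamma;\emptyset\vdash_{\mathcal I}{!}x(y).P::x:{!}A$. (!L) $\Gamma,u:A;\Delta\vdash_{\mathcal I}P::z:C\Rightarrow\Gamma;\Delta,x:{!}A\vdash_{\mathcal I}P\{x/u\}::z:C$. (cutRL) $\Gamma;\Delta\vdash_{\mathcal I}P::x:A$, $\Gamma;\Delta',x:A\vdash_{\mathcal I}Q::z:C\Rightarrow\Gamma;\Delta,\Delta'\vdash_{\mathcal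 I}\nu x(P|Q)::z:C$. (cutLR) $\Gamma;\Delta,x:A\vdash_{\mathcal I}P::z:C$, $\Gamma;\Delta'\vdash_{\mathcal I}Q::x:A\Rightarrow\Gamma;\Delta,\Delta'\vdash_{\mathcal I}\nu x(P|Q)::z:C$. (cut!R) $\Gamma,u:A;\Delta\vdash_{\mathcal I}P::z:C$, $\Gamma;\emptyset\vdash_{\mathcal I}Q::x:A\Rightarrow\Gamma;\Delta\vdash_{\mathcal I}\nu u(P|{!}u(x).Q)::z:C$. (cut!L) $\Gamma;\emptyset\vdash_{\mathcal I}P::x:A$, $\Gamma,u:A;\Delta\vdash_{\mathcal I}Q::z:C\Rightarrow\Gamma;\Delta\vdash_{\mathcal I}\nu u({!}u(x).P|Q)::z:C$.
   Formalization: The index sets I of ⊕, & and branching are required to be non-empty; with I empty, (3) does not imply (1), e.g. for νa(νb(y▷{} | b().z1[].0) | a().z2[].0). -}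

module Defs where

open import Data.Bool using (if_then_else_)
open import Data.Empty using (⊥)
open import Data.List using (List; []; _∷_; _++_; map; filter; foldr; length)
open import Data.List.Membership.Propositional using (_∈_; _∉_)
open import Data.List.NonEmpty using (List⁺; toList)
open import Data.List.Relation.Binary.Permutation.Propositional using (_↭_)
open import Data.List.Relation.Unary.All as All using (All; []; _∷_)
open import Data.List.Relation.Unary.Linked using (Linked)
open import Data.List.Relation.Unary.Unique.Propositional using (Unique)
open import Data.Nat using (ℕ; suc; _<_; _⊔_; _≟_)
open import Data.Product using (_×_; _,_; proj₁)
open import Data.Unit using (⊤)
open import Relation.Nullary using (does; ¬?)

Name : Set
Name = ℕ

Label : Set
Label = ℕ

-- A finite set I of labels is its strictly ascending enumeration, so that
-- equal sets are equal records.  Choices are over non-empty I, as usual for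
-- session types; this matters: a branching without branches could be typed
-- with an arbitrary Λ.
record LabelSet : Set where
  constructor labelSet
  field
    labels    : List⁺ Label
    ascending : Linked _<_ (toList labels)

  elems : List Label
  elems = toList labels

open LabelSet public using (elems)

-- Families {i : aᵢ} indexed by i ∈ I; the member at j∈I is All.lookup as j∈I.
Family : Set → List Label → Set
Family X = All (λ _ → X)

------------------------------------------------------------------------
-- Types

data Logic : Set where
  ull ill : Logic

infixr 8 ‼_ ⁇_
infixr 7 _⊗_ _⊸_ _⅋_

-- Ty ull is the full grammar; Ty ill is the one without bottom and why-not.
-- ‼ and ⁇ are the exponentials ! and ?.
data Ty : Logic → Set where
  𝟏    : ∀ {t} → Ty t
  bot  : Ty ull
  _⊗_  : ∀ {t} → Ty t → Ty t → Ty t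
  _⊸_  : ∀ {t} → Ty t → Ty t → Ty t
  ⊕    : ∀ {t} (I : LabelSet) → Family (Ty t) (elems I) → Ty t
  &    : ∀ {t} (I : LabelSet) → Family (Ty t) (elems I) → Ty t
  ‼_   : ∀ {t} → Ty t → Ty t
  ⁇_   : Ty ull → Ty ull

mutual
  dual : Ty ull → Ty ull
  dual 𝟏        = bot
  dual bot      = 𝟏
  dual (A ⊗ B)  = A ⊸ dual B
  dual (A ⊸ B)  = A ⊗ dual B
  dual (⊕ I As) = & I (duals As)
  dual (& I As) = ⊕ I (duals As)
  dual (‼ A)    = ⁇ dual A
  dual (⁇ A)    = ‼ dual A

  duals : ∀ {ls} → Family (Ty ull) ls → Family (Ty ull) ls
  duals []       = []
  duals (A ∷ As) = dual A ∷ duals As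

_⅋_ : Ty ull → Ty ull → Ty ull
A ⅋ B = dual A ⊸ B

------------------------------------------------------------------------
-- Processes

infixr 6 _∣_
infixr 7 _[_]∙_ _⦅_⦆∙_ !_⦅_⦆∙_ _◁_∙_ _[]∙_ _⦅⦆∙_

data Proc : Set where
  𝟎       : Proc
  ν       : Name → Proc → Proc
  _∣_     : Proc → Proc → Proc
  _[_]∙_  : Name → Name → Proc → Proc
  _⦅_⦆∙_  : Name → Name → Proc → Proc
  _◁_∙_   : Name → Label → Proc → Proc
  branch  : Name → (I : LabelSet) → Family Proc (elems I) → Proc
  !_⦅_⦆∙_ : Name → Name → Proc → Proc
  fwd     : Name → Name → Proc
  _[]∙_   : Name → Proc → Proc
  _⦅⦆∙_   : Name → Proc → Proc

_∖_ : List Name → Name → List Name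
xs ∖ y = filter (λ x → ¬? (x ≟ y)) xs

mutual
  fn : Proc → List Name
  fn 𝟎               = []
  fn (ν y P)         = fn P ∖ y
  fn (P ∣ Q)         = fn P ++ fn Q
  fn (x [ y ]∙ P)    = x ∷ y ∷ fn P
  fn (x ⦅ y ⦆∙ P)    = x ∷ (fn P ∖ y)
  fn (x ◁ _ ∙ P)     = x ∷ fn P
  fn (branch x _ Ps) = x ∷ fns Ps
  fn (! x ⦅ y ⦆∙ P)  = x ∷ (fn P ∖ y)
  fn (fwd x y)       = x ∷ y ∷ []
  fn (x []∙ P)       = x ∷ fn P
  fn (x ⦅⦆∙ P)       = x ∷ fn P

  fns : ∀ {ls} → Family Proc ls → List Name
  fns []       = []
  fns (P ∷ Ps) = fn P ++ fns Ps

fresh : List Name → Name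
fresh xs = suc (foldr _⊔_ 0 xs)

_[_↦_] : (Name → Name) → Name → Name → (Name → Name)
(ρ [ y ↦ z ]) x = if does (x ≟ y) then z else ρ x

-- The name that replaces a binder y with body P under ren ρ: it differs from
-- the images of all other free names of P, hence captures none of them.
freshBinder : (Name → Name) → Name → Proc → Name
freshBinder ρ y P = fresh (map ρ (fn P ∖ y))

-- Simultaneous capture-avoiding renaming of free names.
mutual
  ren : (Name → Name) → Proc → Proc
  ren ρ 𝟎                = 𝟎
  ren ρ (ν y P)          = let z = freshBinder ρ y P in
                           ν z (ren (ρ [ y ↦ z ]) P)
  ren ρ (P ∣ Q)          = ren ρ P ∣ ren ρ Q
  ren ρ (x [ y ]∙ P)     = ρ x [ ρ y ]∙ ren ρ P
  ren ρ (x ⦅ y ⦆∙ P)     = let z = freshBinder ρ y P in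
                           ρ x ⦅ z ⦆∙ ren (ρ [ y ↦ z ]) P
  ren ρ (x ◁ ℓ ∙ P)      = ρ x ◁ ℓ ∙ ren ρ P
  ren ρ (branch x I Ps)  = branch (ρ x) I (rens ρ Ps)
  ren ρ (! x ⦅ y ⦆∙ P)   = let z = freshBinder ρ y P in
                           ! ρ x ⦅ z ⦆∙ ren (ρ [ y ↦ z ]) P
  ren ρ (fwd x y)        = fwd (ρ x) (ρ y)
  ren ρ (x []∙ P)        = ρ x []∙ ren ρ P
  ren ρ (x ⦅⦆∙ P)        = ρ x ⦅⦆∙ ren ρ P

  rens : ∀ {ls} → (Name → Name) → Family Proc ls → Family Proc ls
  rens ρ []       = []
  rens ρ (P ∷ Ps) = ren ρ P ∷ rens ρ Ps

infixl 9 _⟦_/_⟧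

-- P ⟦ y / x ⟧ is P{y/x}: y replaces x.
_⟦_/_⟧ : Proc → Name → Name → Proc
P ⟦ y / x ⟧ = ren ((λ z → z) [ x ↦ y ]) P

infix 4 _≡α_

data _≡α_ : Proc → Proc → Set where
  α-ν    : ∀ {y z P} → z ∉ fn P ∖ y → ν y P ≡α ν z (P ⟦ z / y ⟧)
  α-recv : ∀ {x y z P} → z ∉ fn P ∖ y → x ⦅ y ⦆∙ P ≡α x ⦅ z ⦆∙ P ⟦ z / y ⟧
  α-serv : ∀ {x y z P} → z ∉ fn P ∖ y → ! x ⦅ y ⦆∙ P ≡α ! x ⦅ z ⦆∙ P ⟦ z / y ⟧

  α-refl  : ∀ {P} → P ≡α P
  α-sym   : ∀ {P Q} → P ≡α Q → Q ≡α P
  α-trans : ∀ {P Q R} → P ≡α Q → Q ≡α R → P ≡α R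

  ν-cong      : ∀ {y P P′} → P ≡α P′ → ν y P ≡α ν y P′
  ∣-cong      : ∀ {P P′ Q Q′} → P ≡α P′ → Q ≡α Q′ → P ∣ Q ≡α P′ ∣ Q′
  send-cong   : ∀ {x y P P′} → P ≡α P′ → x [ y ]∙ P ≡α x [ y ]∙ P′
  recv-cong   : ∀ {x y P P′} → P ≡α P′ → x ⦅ y ⦆∙ P ≡α x ⦅ y ⦆∙ P′
  sel-cong    : ∀ {x ℓ P P′} → P ≡α P′ → x ◁ ℓ ∙ P ≡α x ◁ ℓ ∙ P′
  branch-cong : ∀ {x I} {Ps Ps′ : Family Proc (elems I)} →
                (∀ {i} (i∈I : i ∈ elems I) →
                   All.lookup Ps i∈I ≡α All.lookup Ps′ i∈I) →
                branch x I Ps ≡α branch x I Ps′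
  serv-cong   : ∀ {x y P P′} → P ≡α P′ → ! x ⦅ y ⦆∙ P ≡α ! x ⦅ y ⦆∙ P′
  close-cong  : ∀ {x P P′} → P ≡α P′ → x []∙ P ≡α x []∙ P′
  wait-cong   : ∀ {x P P′} → P ≡α P′ → x ⦅⦆∙ P ≡α x ⦅⦆∙ P′

------------------------------------------------------------------------
-- Sequents

infix 6 _⦂_
pattern _⦂_ x A = x , A

-- Contexts are finite sets: Distinct rules out repetitions and _≋_ forgets
-- the order.
Ctx : Logic → Set
Ctx t = List (Name × Ty t)

names : ∀ {t} → Ctx t → List Name
names = map proj₁

infix 4 _⨾_⊢_::_

record Sequent (t : Logic) : Set where
  constructor _⨾_⊢_::_
  field
    unrestricted : Ctx t
    left         : Ctx t
    process      : Proc
    right        : Ctx t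

Distinct : ∀ {t} → Sequent t → Set
Distinct (Γ ⨾ Δ ⊢ _ :: Λ) = Unique (names (Γ ++ Δ ++ Λ))

r-degree : ∀ {t} → Sequent t → ℕ
r-degree (_ ⨾ _ ⊢ _ :: Λ) = length Λ

infix 3 _≋_

data _≋_ {t : Logic} : Sequent t → Sequent t → Set where
  same : ∀ {Γ Γ′ Δ Δ′ P P′ Λ Λ′} →
         Γ ↭ Γ′ → Δ ↭ Δ′ → P ≡α P′ → Λ ↭ Λ′ →
         (Γ ⨾ Δ ⊢ P :: Λ) ≋ (Γ′ ⨾ Δ′ ⊢ P′ :: Λ′)

------------------------------------------------------------------------
-- Derivations

-- R premises conclusion
Rules : Logic → Set₁
Rules t = List (Sequent t) → Sequent t → Set

-- conv is not an inference: it identifies representatives of the same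
-- sequent, contexts being sets and processes being taken up to α-renaming.
data Derivation {t : Logic} (R : Rules t) : Sequent t → Set where
  rule : ∀ {ps c} → Distinct c → R ps c → All (Derivation R) ps → Derivation R c
  conv : ∀ {s s′} → s ≋ s′ → Derivation R s → Derivation R s′

mutual
  EverySequent : ∀ {t} {R : Rules t} {c : Sequent t} →
                 (Sequent t → Set) → Derivation R c → Set
  EverySequent {c = c} φ (rule _ _ ds) = φ c × EverySequents φ ds
  EverySequent {c = c} φ (conv _ d)    = φ c × EverySequent φ d

  EverySequents : ∀ {t} {R : Rules t} {ps : List (Sequent t)} →
                  (Sequent t → Set) → All (Derivation R) ps → Set
  EverySequents φ []       = ⊤
  EverySequents φ (d ∷ ds) = EverySequent φ d × EverySequents φ ds

mutual
  EveryRule : ∀ {t} {R : Rules t} {c : Sequent t} →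
              (∀ {ps c′} → R ps c′ → Set) → Derivation R c → Set
  EveryRule φ (rule _ r ds) = φ r × EveryRules φ ds
  EveryRule φ (conv _ d)    = EveryRule φ d

  EveryRules : ∀ {t} {R : Rules t} {ps : List (Sequent t)} →
               (∀ {ps′ c′} → R ps′ c′ → Set) → All (Derivation R) ps → Set
  EveryRules φ []       = ⊤
  EveryRules φ (d ∷ ds) = EveryRule φ d × EveryRules φ ds

-- The premises s Aᵢ Pᵢ, one for each i ∈ I.
forEach : ∀ {t ls} → (Ty t → Proc → Sequent t) →
          Family (Ty t) ls → Family Proc ls → List (Sequent t)
forEach s As Ps = All.reduce (λ (A , P) → s A P) (All.zip (As , Ps))

------------------------------------------------------------------------
-- Inference rules

-- In the rules that output a bound name y, y is typed only in the premise
-- for P but its scope νy includes Q.  The condition on y keeps it from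
-- capturing a name of Q; it is implicit in the convention that bound names
-- differ from free ones.  Distinct, imposed on all sequents, supplies every
-- other freshness condition.

private variable
  t : Logic
  Γ Δ Δ′ Λ Λ′ : Ctx t
  A B C : Ty t
  P Q : Proc
  x y z u : Name

data Starred : Rules ull where
  idR : Starred []
                (Γ ⨾ x ⦂ A ∷ [] ⊢ fwd x y :: y ⦂ A ∷ [])

  1R : Starred []
               (Γ ⨾ [] ⊢ x []∙ 𝟎 :: x ⦂ 𝟏 ∷ [])
  1L : Starred ((Γ ⨾ Δ ⊢ P :: Λ) ∷ [])
               (Γ ⨾ x ⦂ 𝟏 ∷ Δ ⊢ x ⦅⦆∙ P :: Λ)

  ⊗R : y ∉ names (Δ′ ++ x ⦂ B ∷ Λ′) →
       Starred ((Γ ⨾ Δ ⊢ P :: y ⦂ A ∷ Λ) ∷ (Γ ⨾ Δ′ ⊢ Q :: x ⦂ B ∷ Λ′) ∷ [])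
               (Γ ⨾ Δ ++ Δ′ ⊢ ν y (x [ y ]∙ (P ∣ Q)) :: x ⦂ A ⊗ B ∷ Λ ++ Λ′)
  ⊗L : Starred ((Γ ⨾ y ⦂ A ∷ x ⦂ B ∷ Δ ⊢ P :: Λ) ∷ [])
               (Γ ⨾ x ⦂ A ⊗ B ∷ Δ ⊢ x ⦅ y ⦆∙ P :: Λ)

  ⊸R : Starred ((Γ ⨾ y ⦂ A ∷ Δ ⊢ P :: x ⦂ B ∷ Λ) ∷ [])
               (Γ ⨾ Δ ⊢ x ⦅ y ⦆∙ P :: x ⦂ A ⊸ B ∷ Λ)
  ⊸L : y ∉ names (x ⦂ B ∷ Δ′ ++ Λ′) →
       Starred ((Γ ⨾ Δ ⊢ P :: y ⦂ A ∷ Λ) ∷ (Γ ⨾ x ⦂ B ∷ Δ′ ⊢ Q :: Λ′) ∷ [])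
               (Γ ⨾ x ⦂ A ⊸ B ∷ Δ ++ Δ′ ⊢ ν y (x [ y ]∙ (P ∣ Q)) :: Λ ++ Λ′)

  ⊕R : ∀ {I j} {As : Family (Ty ull) (elems I)} (j∈I : j ∈ elems I) →
       Starred ((Γ ⨾ Δ ⊢ P :: x ⦂ All.lookup As j∈I ∷ Λ) ∷ [])
               (Γ ⨾ Δ ⊢ x ◁ j ∙ P :: x ⦂ ⊕ I As ∷ Λ)
  ⊕L : ∀ {I} {As : Family (Ty ull) (elems I)} {Ps : Family Proc (elems I)} →
       Starred (forEach (λ Aᵢ Pᵢ → Γ ⨾ x ⦂ Aᵢ ∷ Δ ⊢ Pᵢ :: Λ) As Ps)
               (Γ ⨾ x ⦂ ⊕ I As ∷ Δ ⊢ branch x I Ps :: Λ)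

  &R : ∀ {I} {As : Family (Ty ull) (elems I)} {Ps : Family Proc (elems I)} →
       Starred (forEach (λ Aᵢ Pᵢ → Γ ⨾ Δ ⊢ Pᵢ :: x ⦂ Aᵢ ∷ Λ) As Ps)
               (Γ ⨾ Δ ⊢ branch x I Ps :: x ⦂ & I As ∷ Λ)
  &L : ∀ {I j} {As : Family (Ty ull) (elems I)} (j∈I : j ∈ elems I) →
       Starred ((Γ ⨾ x ⦂ All.lookup As j∈I ∷ Δ ⊢ P :: Λ) ∷ [])
               (Γ ⨾ x ⦂ & I As ∷ Δ ⊢ x ◁ j ∙ P :: Λ)

  copyL : Starred ((u ⦂ A ∷ Γ ⨾ x ⦂ A ∷ Δ ⊢ P :: Λ) ∷ [])
                  (u ⦂ A ∷ Γ ⨾ Δ ⊢ ν x (u [ x ]∙ P) :: Λ)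

  !R : Starred ((Γ ⨾ [] ⊢ P :: y ⦂ A ∷ []) ∷ [])
               (Γ ⨾ [] ⊢ ! x ⦅ y ⦆∙ P :: x ⦂ ‼ A ∷ [])
  !L : Starred ((u ⦂ A ∷ Γ ⨾ Δ ⊢ P :: Λ) ∷ [])
               (Γ ⨾ x ⦂ ‼ A ∷ Δ ⊢ P ⟦ x / u ⟧ :: Λ)

  cutRL : Starred ((Γ ⨾ Δ ⊢ P :: x ⦂ A ∷ Λ) ∷ (Γ ⨾ x ⦂ A ∷ Δ′ ⊢ Q :: Λ′) ∷ [])
                  (Γ ⨾ Δ ++ Δ′ ⊢ ν x (P ∣ Q) :: Λ ++ Λ′)
  cutLR : Starred ((Γ ⨾ x ⦂ A ∷ Δ ⊢ P :: Λ) ∷ (Γ ⨾ Δ′ ⊢ Q :: x ⦂ A ∷ Λ′) ∷ [])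
                  (Γ ⨾ Δ ++ Δ′ ⊢ ν x (P ∣ Q) :: Λ ++ Λ′)

  cut!R : Starred ((u ⦂ A ∷ Γ ⨾ Δ ⊢ P :: Λ) ∷ (Γ ⨾ [] ⊢ Q :: x ⦂ A ∷ []) ∷ [])
                  (Γ ⨾ Δ ⊢ ν u (P ∣ ! u ⦅ x ⦆∙ Q) :: Λ)
  cut!L : Starred ((Γ ⨾ [] ⊢ P :: x ⦂ A ∷ []) ∷ (u ⦂ A ∷ Γ ⨾ Δ ⊢ Q :: Λ) ∷ [])
                  (Γ ⨾ Δ ⊢ ν u ((! u ⦅ x ⦆∙ P) ∣ Q) :: Λ)

data Unstarred : Rules ull where
  idL : Unstarred []
                  (Γ ⨾ x ⦂ A ∷ y ⦂ dual A ∷ [] ⊢ fwd x y :: [])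

  ⊥R : Unstarred ((Γ ⨾ Δ ⊢ P :: Λ) ∷ [])
                 (Γ ⨾ Δ ⊢ x ⦅⦆∙ P :: x ⦂ bot ∷ Λ)
  ⊥L : Unstarred []
                 (Γ ⨾ x ⦂ bot ∷ [] ⊢ x []∙ 𝟎 :: [])

  ⅋R : Unstarred ((Γ ⨾ Δ ⊢ P :: y ⦂ A ∷ x ⦂ B ∷ Λ) ∷ [])
                 (Γ ⨾ Δ ⊢ x ⦅ y ⦆∙ P :: x ⦂ A ⅋ B ∷ Λ)
  ⅋L : y ∉ names (x ⦂ B ∷ Δ′ ++ Λ′) →
       Unstarred ((Γ ⨾ y ⦂ A ∷ Δ ⊢ P :: Λ) ∷ (Γ ⨾ x ⦂ B ∷ Δ′ ⊢ Q :: Λ′) ∷ [])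
                 (Γ ⨾ x ⦂ A ⅋ B ∷ Δ ++ Δ′ ⊢ ν y (x [ y ]∙ (P ∣ Q)) :: Λ ++ Λ′)

  copyR : Unstarred ((u ⦂ A ∷ Γ ⨾ Δ ⊢ P :: x ⦂ dual A ∷ Λ) ∷ [])
                    (u ⦂ A ∷ Γ ⨾ Δ ⊢ ν x (u [ x ]∙ P) :: Λ)

  ?R : Unstarred ((u ⦂ A ∷ Γ ⨾ Δ ⊢ P :: Λ) ∷ [])
                 (Γ ⨾ Δ ⊢ P ⟦ x / u ⟧ :: x ⦂ ⁇ dual A ∷ Λ)
  ?L : Unstarred ((Γ ⨾ y ⦂ A ∷ [] ⊢ P :: []) ∷ [])
                 (Γ ⨾ x ⦂ ⁇ A ∷ [] ⊢ ! x ⦅ y ⦆∙ P :: [])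

  cutRR : Unstarred ((Γ ⨾ Δ ⊢ P :: x ⦂ A ∷ Λ) ∷ (Γ ⨾ Δ′ ⊢ Q :: x ⦂ dual A ∷ Λ′) ∷ [])
                    (Γ ⨾ Δ ++ Δ′ ⊢ ν x (P ∣ Q) :: Λ ++ Λ′)
  cutLL : Unstarred ((Γ ⨾ x ⦂ A ∷ Δ ⊢ P :: Λ) ∷ (Γ ⨾ x ⦂ dual A ∷ Δ′ ⊢ Q :: Λ′) ∷ [])
                    (Γ ⨾ Δ ++ Δ′ ⊢ ν x (P ∣ Q) :: Λ ++ Λ′)

  cut?R : Unstarred ((u ⦂ A ∷ Γ ⨾ Δ ⊢ P :: Λ) ∷ (Γ ⨾ x ⦂ dual A ∷ [] ⊢ Q :: []) ∷ [])
                    (Γ ⨾ Δ ⊢ ν u (P ∣ ! u ⦅ x ⦆∙ Q) :: Λ)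
  cut?L : Unstarred ((Γ ⨾ x ⦂ dual A ∷ [] ⊢ P :: []) ∷ (u ⦂ A ∷ Γ ⨾ Δ ⊢ Q :: Λ) ∷ [])
                    (Γ ⨾ Δ ⊢ ν u ((! u ⦅ x ⦆∙ P) ∣ Q) :: Λ)

data πULL : Rules ull where
  starred   : ∀ {ps c} → Starred ps c → πULL ps c
  unstarred : ∀ {ps c} → Unstarred ps c → πULL ps c

data πULL↷ : Rules ull where
  starred : ∀ {ps c} → Starred ps c → πULL↷ ps c
  ↶ : πULL↷ ((Γ ⨾ Δ ⊢ P :: x ⦂ A ∷ Λ) ∷ [])
            (Γ ⨾ x ⦂ dual A ∷ Δ ⊢ P :: Λ)
  ↷ : πULL↷ ((Γ ⨾ x ⦂ A ∷ Δ ⊢ P :: Λ) ∷ [])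
            (Γ ⨾ Δ ⊢ P :: x ⦂ dual A ∷ Λ)

Neither↶nor↷ : ∀ {ps c} → πULL↷ ps c → Set
Neither↶nor↷ (starred _) = ⊤
Neither↶nor↷ ↶           = ⊥
Neither↶nor↷ ↷           = ⊥

data πILL : Rules ill where
  id : πILL []
            (Γ ⨾ x ⦂ A ∷ [] ⊢ fwd x y :: y ⦂ A ∷ [])

  1R : πILL []
            (Γ ⨾ [] ⊢ x []∙ 𝟎 :: x ⦂ 𝟏 ∷ [])
  1L : πILL ((Γ ⨾ Δ ⊢ P :: z ⦂ C ∷ []) ∷ [])
            (Γ ⨾ x ⦂ 𝟏 ∷ Δ ⊢ x ⦅⦆∙ P :: z ⦂ C ∷ [])

  ⊗R : y ∉ names (Δ′ ++ x ⦂ B ∷ []) →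
       πILL ((Γ ⨾ Δ ⊢ P :: y ⦂ A ∷ []) ∷ (Γ ⨾ Δ′ ⊢ Q :: x ⦂ B ∷ []) ∷ [])
            (Γ ⨾ Δ ++ Δ′ ⊢ ν y (x [ y ]∙ (P ∣ Q)) :: x ⦂ A ⊗ B ∷ [])
  ⊗L : πILL ((Γ ⨾ y ⦂ A ∷ x ⦂ B ∷ Δ ⊢ P :: z ⦂ C ∷ []) ∷ [])
            (Γ ⨾ x ⦂ A ⊗ B ∷ Δ ⊢ x ⦅ y ⦆∙ P :: z ⦂ C ∷ [])

  ⊸R : πILL ((Γ ⨾ y ⦂ A ∷ Δ ⊢ P :: x ⦂ B ∷ []) ∷ [])
            (Γ ⨾ Δ ⊢ x ⦅ y ⦆∙ P :: x ⦂ A ⊸ B ∷ [])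
  ⊸L : y ∉ names (x ⦂ B ∷ Δ′ ++ z ⦂ C ∷ []) →
       πILL ((Γ ⨾ Δ ⊢ P :: y ⦂ A ∷ []) ∷ (Γ ⨾ x ⦂ B ∷ Δ′ ⊢ Q :: z ⦂ C ∷ []) ∷ [])
            (Γ ⨾ x ⦂ A ⊸ B ∷ Δ ++ Δ′ ⊢ ν y (x [ y ]∙ (P ∣ Q)) :: z ⦂ C ∷ [])

  ⊕R : ∀ {I j} {As : Family (Ty ill) (elems I)} (j∈I : j ∈ elems I) →
       πILL ((Γ ⨾ Δ ⊢ P :: x ⦂ All.lookup As j∈I ∷ []) ∷ [])
            (Γ ⨾ Δ ⊢ x ◁ j ∙ P :: x ⦂ ⊕ I As ∷ [])
  ⊕L : ∀ {I} {As : Family (Ty ill) (elems I)} {Ps : Family Proc (elems I)} →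
       πILL (forEach (λ Aᵢ Pᵢ → Γ ⨾ x ⦂ Aᵢ ∷ Δ ⊢ Pᵢ :: z ⦂ C ∷ []) As Ps)
            (Γ ⨾ x ⦂ ⊕ I As ∷ Δ ⊢ branch x I Ps :: z ⦂ C ∷ [])

  &R : ∀ {I} {As : Family (Ty ill) (elems I)} {Ps : Family Proc (elems I)} →
       πILL (forEach (λ Aᵢ Pᵢ → Γ ⨾ Δ ⊢ Pᵢ :: x ⦂ Aᵢ ∷ []) As Ps)
            (Γ ⨾ Δ ⊢ branch x I Ps :: x ⦂ & I As ∷ [])
  &L : ∀ {I j} {As : Family (Ty ill) (elems I)} (j∈I : j ∈ elems I) →
       πILL ((Γ ⨾ x ⦂ All.lookup As j∈I ∷ Δ ⊢ P :: z ⦂ C ∷ []) ∷ [])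
            (Γ ⨾ x ⦂ & I As ∷ Δ ⊢ x ◁ j ∙ P :: z ⦂ C ∷ [])

  copy : πILL ((u ⦂ A ∷ Γ ⨾ x ⦂ A ∷ Δ ⊢ P :: z ⦂ C ∷ []) ∷ [])
              (u ⦂ A ∷ Γ ⨾ Δ ⊢ ν x (u [ x ]∙ P) :: z ⦂ C ∷ [])

  !R : πILL ((Γ ⨾ [] ⊢ P :: y ⦂ A ∷ []) ∷ [])
            (Γ ⨾ [] ⊢ ! x ⦅ y ⦆∙ P :: x ⦂ ‼ A ∷ [])
  !L : πILL ((u ⦂ A ∷ Γ ⨾ Δ ⊢ P :: z ⦂ C ∷ []) ∷ [])
            (Γ ⨾ x ⦂ ‼ A ∷ Δ ⊢ P ⟦ x / u ⟧ :: z ⦂ C ∷ [])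

  cutRL : πILL ((Γ ⨾ Δ ⊢ P :: x ⦂ A ∷ []) ∷ (Γ ⨾ x ⦂ A ∷ Δ′ ⊢ Q :: z ⦂ C ∷ []) ∷ [])
               (Γ ⨾ Δ ++ Δ′ ⊢ ν x (P ∣ Q) :: z ⦂ C ∷ [])
  cutLR : πILL ((Γ ⨾ x ⦂ A ∷ Δ ⊢ P :: z ⦂ C ∷ []) ∷ (Γ ⨾ Δ′ ⊢ Q :: x ⦂ A ∷ []) ∷ [])
               (Γ ⨾ Δ ++ Δ′ ⊢ ν x (P ∣ Q) :: z ⦂ C ∷ [])

  cut!R : πILL ((u ⦂ A ∷ Γ ⨾ Δ ⊢ P :: z ⦂ C ∷ []) ∷ (Γ ⨾ [] ⊢ Q :: x ⦂ A ∷ []) ∷ [])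
               (Γ ⨾ Δ ⊢ ν u (P ∣ ! u ⦅ x ⦆∙ Q) :: z ⦂ C ∷ [])
  cut!L : πILL ((Γ ⨾ [] ⊢ P :: x ⦂ A ∷ []) ∷ (u ⦂ A ∷ Γ ⨾ Δ ⊢ Q :: z ⦂ C ∷ []) ∷ [])
               (Γ ⨾ Δ ⊢ ν u ((! u ⦅ x ⦆∙ P) ∣ Q) :: z ⦂ C ∷ [])

{-# OPTIONS --safe #-}

-- In a πULL derivation whose sequents all have r-degree 1 no unstarred rule can
-- occur: each of them has a premise or a conclusion of another r-degree.
-- Conversely the starred rules alone only derive sequents of r-degree 1 (for
-- the branching rules because choices are non-empty).  The starred rules never
-- inspect ⊥ or ?, so that replacing all subformulas ⊥ and ?A by 𝟏 turns a
-- derivation with starred rules into one of πILL.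
module Submission where

open import Defs
open import Data.List using (List; []; _∷_; _++_; map)
open import Data.List.Membership.Propositional using (_∈_; _∉_)
open import Data.List.Properties using (map-++; map-∘)
open import Data.List.Relation.Binary.Permutation.Propositional.Properties
  using (map⁺; ↭-length)
open import Data.List.Relation.Unary.All as All using (All; []; _∷_)
open import Data.List.Relation.Unary.Any using (here; there)
open import Data.List.Relation.Unary.Unique.Propositional using (Unique)
open import Data.Product using (_×_; _,_; map₂; ∃-syntax)
open import Data.Unit using (⊤; tt)
open import Function using (_∘_)
open import Function.Bundles using (_⇔_; mk⇔)
open import Relation.Binary.PropositionalEquality
  using (_≡_; refl; sym; trans; cong; cong₂; subst)

private variable
  s t : Logic
  R S : Rules s
  φ   : Sequent s → Set
  c   : Sequent s
  ps  : List (Sequent s)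

-- Derivations

-- Used for the branching rules, whose premise lists are computed by `forEach` and match their
-- translations only up to a proof of equality.
replacePremises : (R : Rules s) → ∀ {ps ps′ c} → ps ≡ ps′ → R ps c → R ps′ c
replacePremises R refl r = r

mutual
  mapRules : (∀ {ps c} → R ps c → S ps c) → Derivation R c → Derivation S c
  mapRules h (rule u r ds) = rule u (h r) (mapRulesAll h ds)
  mapRules h (conv e d)    = conv e (mapRules h d)

  mapRulesAll : (∀ {ps c} → R ps c → S ps c) →
                All (Derivation R) ps → All (Derivation S) ps
  mapRulesAll h []       = []
  mapRulesAll h (d ∷ ds) = mapRules h d ∷ mapRulesAll h ds

mutual
  everyRule-mapRules : {ψ : ∀ {ps c} → S ps c → Set}
                       (h : ∀ {ps c} → R ps c → S ps c) →
                       (∀ {ps c} (r : R ps c) → ψ (h r)) →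
                       (d : Derivation R c) → EveryRule ψ (mapRules h d)
  everyRule-mapRules h p (rule _ r ds) = p r , everyRules-mapRules h p ds
  everyRule-mapRules h p (conv _ d)    = everyRule-mapRules h p d

  everyRules-mapRules : {ψ : ∀ {ps c} → S ps c → Set}
                        (h : ∀ {ps c} → R ps c → S ps c) →
                        (∀ {ps c} (r : R ps c) → ψ (h r)) →
                        (ds : All (Derivation R) ps) →
                        EveryRules ψ (mapRulesAll h ds)
  everyRules-mapRules h p []       = tt
  everyRules-mapRules h p (d ∷ ds) =
    everyRule-mapRules h p d , everyRules-mapRules h p ds

mutual
  everySequent-mapRules : (h : ∀ {ps c} → R ps c → S ps c) →
                          (d : Derivation R c) →
                          EverySequent φ d → EverySequent φ (mapRules h d)
  everySequent-mapRules h (rule _ _ ds) (p , q) =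
    p , everySequents-mapRules h ds q
  everySequent-mapRules h (conv _ d)    (p , q) =
    p , everySequent-mapRules h d q

  everySequents-mapRules : (h : ∀ {ps c} → R ps c → S ps c) →
                           (ds : All (Derivation R) ps) →
                           EverySequents φ ds →
                           EverySequents φ (mapRulesAll h ds)
  everySequents-mapRules h []       _       = tt
  everySequents-mapRules h (d ∷ ds) (p , q) =
    everySequent-mapRules h d p , everySequents-mapRules h ds q

conclusion : {d : Derivation R c} → EverySequent φ d → φ c
conclusion {d = rule _ _ _} (p , _) = p
conclusion {d = conv _ _}   (p , _) = p

conclusions : (ds : All (Derivation R) ps) → EverySequents φ ds → All φ ps
conclusions []       _       = []
conclusions (d ∷ ds) (p , q) = conclusion {d = d} p ∷ conclusions ds q

mutual
  -- `EverySequent` also constrains both sides of each `conv`, so `φ` must respect `≋`.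
  invariant : (∀ {ps c} → R ps c → All φ ps → φ c) →
              (∀ {c c′} → c ≋ c′ → φ c → φ c′) →
              (d : Derivation R c) → EverySequent φ d
  invariant step resp (rule _ r ds) =
    let ps = invariants step resp ds in step r (conclusions ds ps) , ps
  invariant step resp (conv e d)    =
    let p = invariant step resp d in resp e (conclusion {d = d} p) , p

  invariants : (∀ {ps c} → R ps c → All φ ps → φ c) →
               (∀ {c c′} → c ≋ c′ → φ c → φ c′) →
               (ds : All (Derivation R) ps) → EverySequents φ ds
  invariants step resp []       = tt
  invariants step resp (d ∷ ds) =
    invariant step resp d , invariants step resp ds

-- Translation of types

mutual
  -- One function serves both directions: on `Ty ull` it collapses `bot` and `⁇ A` to `𝟏`, on
  -- `Ty ill` it is the inclusion into the full grammar. It does not commute with `dual`, which no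
  -- starred rule mentions.
  tr : Ty s → Ty t
  tr 𝟏        = 𝟏
  tr bot      = 𝟏
  tr (A ⊗ B)  = tr A ⊗ tr B
  tr (A ⊸ B)  = tr A ⊸ tr B
  tr (⊕ I As) = ⊕ I (trs As)
  tr (& I As) = & I (trs As)
  tr (‼ A)    = ‼ tr A
  tr (⁇ A)    = 𝟏

  trs : ∀ {ls} → Family (Ty s) ls → Family (Ty t) ls
  trs []       = []
  trs (A ∷ As) = tr A ∷ trs As

trCtx : Ctx s → Ctx t
trCtx = map (map₂ tr)

-- Processes contain no types, so the translated derivation types the very same `P`.
trSeq : Sequent s → Sequent t
trSeq (Γ ⨾ Δ ⊢ P :: Λ) = trCtx Γ ⨾ trCtx Δ ⊢ P :: trCtx Λ

lookup-trs : ∀ {ls j} (As : Family (Ty s) ls) (j∈ls : j ∈ ls) →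
             All.lookup (trs {t = t} As) j∈ls ≡ tr (All.lookup As j∈ls)
lookup-trs (A ∷ As) (here refl)  = refl
lookup-trs (A ∷ As) (there j∈ls) = lookup-trs As j∈ls

forEach-trs : ∀ {ls} {f : Ty s → Proc → Sequent s} {g : Ty t → Proc → Sequent t} →
              (∀ {A P} → trSeq (f A P) ≡ g (tr A) P) →
              (As : Family (Ty s) ls) (Ps : Family Proc ls) →
              map trSeq (forEach f As Ps) ≡ forEach g (trs As) Ps
forEach-trs eq []       []       = refl
forEach-trs eq (A ∷ As) (P ∷ Ps) = cong₂ _∷_ eq (forEach-trs eq As Ps)

-- This is why `Distinct` and the side conditions on bound names survive the translation.
names-trCtx : (Δ : Ctx s) → names (trCtx {t = t} Δ) ≡ names Δ
names-trCtx Δ = sym (map-∘ Δ)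

∉-trCtx : ∀ {y} (Δ Λ : Ctx s) → y ∉ names (Δ ++ Λ) →
          y ∉ names (trCtx {t = t} Δ ++ trCtx Λ)
∉-trCtx Δ Λ = subst (λ xs → _ ∉ xs)
  (trans (sym (names-trCtx (Δ ++ Λ))) (cong names (map-++ _ Δ Λ)))

distinct-trSeq : (c : Sequent s) → Distinct c → Distinct (trSeq {t = t} c)
distinct-trSeq (Γ ⨾ Δ ⊢ _ :: Λ) = subst Unique
  (trans (sym (names-trCtx (Γ ++ Δ ++ Λ)))
    (cong names (trans (map-++ _ Γ (Δ ++ Λ)) (cong (trCtx Γ ++_) (map-++ _ Δ Λ)))))

≋-trSeq : ∀ {c c′ : Sequent s} → c ≋ c′ → trSeq {t = t} c ≋ trSeq c′
≋-trSeq (same Γ Δ P Λ) = same (map⁺ _ Γ) (map⁺ _ Δ) P (map⁺ _ Λ)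

mutual
  -- A rule may be translatable only between sequents satisfying `φ`, so `step` receives `φ` for all
  -- premises and for the conclusion.
  translate : {R : Rules s} {S : Rules t} →
              (∀ {ps c} → R ps c → All φ ps → φ c → S (map trSeq ps) (trSeq c)) →
              (d : Derivation R c) → EverySequent φ d → Derivation S (trSeq c)
  translate {c = c} step (rule u r ds) (p , q) =
    rule (distinct-trSeq c u) (step r (conclusions ds q) p) (translateAll step ds q)
  translate step (conv e d)    (_ , q) = conv (≋-trSeq e) (translate step d q)

  translateAll : {R : Rules s} {S : Rules t} →
                 (∀ {ps c} → R ps c → All φ ps → φ c → S (map trSeq ps) (trSeq c)) →
                 (ds : All (Derivation R) ps) → EverySequents φ ds →
                 All (Derivation S) (map trSeq ps)
  translateAll step []       _       = []
  translateAll step (d ∷ ds) (p , q) = translate step d p ∷ translateAll step ds q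

-- Sequents of r-degree 1

-- An inductive family, so that matching on it solves equations like
-- length (Λ ++ Λ′) ≡ 1 for the contexts.
data Singleton {A : Set} : List A → Set where
  [_] : ∀ x → Singleton (x ∷ [])

RightSingleton : Sequent s → Set
RightSingleton c = Singleton (Sequent.right c)

singleton⇒degree1 : {c : Sequent s} → RightSingleton c → r-degree c ≡ 1
singleton⇒degree1 {c = _ ⨾ _ ⊢ _ :: _} [ _ ] = refl

degree1⇒singleton : {c : Sequent s} → r-degree c ≡ 1 → RightSingleton c
degree1⇒singleton {c = _ ⨾ _ ⊢ _ :: x ∷ []} refl = [ x ]

≋-degree1 : ∀ {c c′ : Sequent s} → c ≋ c′ → r-degree c ≡ 1 → r-degree c′ ≡ 1
≋-degree1 (same _ _ _ Λ↭Λ′) p = trans (sym (↭-length Λ↭Λ′)) p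

-- With two premises, either one is consumed by its single right assignment and the other supplies
-- the right-hand side, or, for `⊗R`, both merge into one.
starred-singleton : Starred ps c → All RightSingleton ps → RightSingleton c
starred-singleton idR         _                   = [ _ ]
starred-singleton 1R          _                   = [ _ ]
starred-singleton 1L          (p ∷ _)             = p
starred-singleton (⊗R _)      ([ _ ] ∷ [ _ ] ∷ _) = [ _ ]
starred-singleton ⊗L          (p ∷ _)             = p
starred-singleton ⊸R          ([ _ ] ∷ _)         = [ _ ]
starred-singleton (⊸L _)      ([ _ ] ∷ p ∷ _)     = p
starred-singleton (⊕R _)      ([ _ ] ∷ _)         = [ _ ]
-- Label sets are non-empty, so the families split and expose a first premise, which determines `Λ`.
starred-singleton (⊕L {As = _ ∷ _} {_ ∷ _}) (p ∷ _)     = p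
starred-singleton (&R {As = _ ∷ _} {_ ∷ _}) ([ _ ] ∷ _) = [ _ ]
starred-singleton (&L _)      (p ∷ _)             = p
starred-singleton copyL       (p ∷ _)             = p
starred-singleton !R          _                   = [ _ ]
starred-singleton !L          (p ∷ _)             = p
starred-singleton cutRL       ([ _ ] ∷ p ∷ _)     = p
starred-singleton cutLR       ([ _ ] ∷ [ _ ] ∷ _) = [ _ ]
starred-singleton cut!R       (p ∷ _)             = p
starred-singleton cut!L       (_ ∷ p ∷ _)         = p

starred-degree1 : (d : Derivation Starred c) → EverySequent (λ s → r-degree s ≡ 1) d
starred-degree1 = invariant
  (λ {_} {c} r ps → singleton⇒degree1 {c = c}
    (starred-singleton r (All.map (λ {s} → degree1⇒singleton {c = s}) ps)))
  ≋-degree1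

-- Translation of rules between the systems

starred⇒πILL : Starred ps c → All RightSingleton ps → RightSingleton c →
               πILL (map trSeq ps) (trSeq c)
starred⇒πILL idR _ _ = id
starred⇒πILL 1R _ _ = 1R
starred⇒πILL 1L _ [ _ ] = 1L
starred⇒πILL (⊗R {Δ′ = Δ′} {Δ = Δ} y∉) ([ _ ] ∷ [ _ ] ∷ _) _
  rewrite map-++ (map₂ (tr {t = ill})) Δ Δ′ = ⊗R (∉-trCtx Δ′ _ y∉)
starred⇒πILL ⊗L _ [ _ ] = ⊗L
starred⇒πILL ⊸R ([ _ ] ∷ _) _ = ⊸R
starred⇒πILL (⊸L {B = B} {Δ′ = Δ′} {Δ = Δ} y∉) ([ _ ] ∷ _) [ _ ]
  rewrite map-++ (map₂ (tr {t = ill})) Δ Δ′ = ⊸L (∉-trCtx (_ ⦂ B ∷ Δ′) _ y∉)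
starred⇒πILL (⊕R {As = As} j∈I) ([ _ ] ∷ _) _
  -- The translated component is turned into a component of the translated family, the form in which
  -- `⊕R` states its premise.
  rewrite sym (lookup-trs {t = ill} As j∈I) = ⊕R j∈I
starred⇒πILL (⊕L {As = As} {Ps}) _ [ _ ] =
  replacePremises πILL (sym (forEach-trs refl As Ps)) ⊕L
starred⇒πILL (&R {As = As} {Ps}) _ [ _ ] =
  replacePremises πILL (sym (forEach-trs refl As Ps)) &R
starred⇒πILL (&L {As = As} j∈I) _ [ _ ]
  rewrite sym (lookup-trs {t = ill} As j∈I) = &L j∈I
starred⇒πILL copyL _ [ _ ] = copy
starred⇒πILL !R _ _ = !R
starred⇒πILL !L _ [ _ ] = !L
starred⇒πILL (cutRL {Δ = Δ} {Δ′ = Δ′}) ([ _ ] ∷ [ _ ] ∷ _) _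
  rewrite map-++ (map₂ (tr {t = ill})) Δ Δ′ = cutRL
starred⇒πILL (cutLR {Δ = Δ} {Δ′ = Δ′}) ([ _ ] ∷ [ _ ] ∷ _) _
  rewrite map-++ (map₂ (tr {t = ill})) Δ Δ′ = cutLR
starred⇒πILL cut!R _ [ _ ] = cut!R
starred⇒πILL cut!L _ [ _ ] = cut!L

-- Singleton premises force a conclusion of degree 0 for `copyR` and `cutRR`, and of degree 2 for
-- `⊥R`, `⅋L`, `?R` and `cutLL`. The axioms `idL` and `⊥L` and the rule `?L` have conclusions of
-- degree 0, `⅋R` has a premise of degree at least 2, and `cut?R` and `cut?L` have one of degree 0.
πULL⇒πILL : πULL ps c → All RightSingleton ps → RightSingleton c →
            πILL (map trSeq ps) (trSeq c)
πULL⇒πILL (starred r)         ps                  p  = starred⇒πILL r ps p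
πULL⇒πILL (unstarred idL)     _                   ()
πULL⇒πILL (unstarred ⊥R)      ([ _ ] ∷ _)         ()
πULL⇒πILL (unstarred ⊥L)      _                   ()
πULL⇒πILL (unstarred ⅋R)      (() ∷ _)            _
πULL⇒πILL (unstarred (⅋L _))  ([ _ ] ∷ [ _ ] ∷ _) ()
πULL⇒πILL (unstarred copyR)   ([ _ ] ∷ _)         ()
πULL⇒πILL (unstarred ?R)      ([ _ ] ∷ _)         ()
πULL⇒πILL (unstarred ?L)      _                   ()
πULL⇒πILL (unstarred cutRR)   ([ _ ] ∷ [ _ ] ∷ _) ()
πULL⇒πILL (unstarred cutLL)   ([ _ ] ∷ [ _ ] ∷ _) ()
πULL⇒πILL (unstarred cut?R)   (_ ∷ () ∷ _)        _
πULL⇒πILL (unstarred cut?L)   (() ∷ _)            _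

πILL⇒starred : πILL ps c → Starred (map trSeq ps) (trSeq c)
πILL⇒starred id = idR
πILL⇒starred 1R = 1R
πILL⇒starred 1L = 1L
πILL⇒starred (⊗R {Δ′ = Δ′} {Δ = Δ} y∉)
  rewrite map-++ (map₂ (tr {t = ull})) Δ Δ′ = ⊗R (∉-trCtx Δ′ _ y∉)
πILL⇒starred ⊗L = ⊗L
πILL⇒starred ⊸R = ⊸R
πILL⇒starred (⊸L {B = B} {Δ′ = Δ′} {Δ = Δ} y∉)
  -- The premise for `P` offers only `y`, so `z ⦂ C` comes entirely from the premise for `Q`.
  rewrite map-++ (map₂ (tr {t = ull})) Δ Δ′ = ⊸L {Λ = []} (∉-trCtx (_ ⦂ B ∷ Δ′) _ y∉)
πILL⇒starred (⊕R {As = As} j∈I)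
  rewrite sym (lookup-trs {t = ull} As j∈I) = ⊕R j∈I
πILL⇒starred (⊕L {As = As} {Ps}) =
  replacePremises Starred (sym (forEach-trs refl As Ps)) ⊕L
πILL⇒starred (&R {As = As} {Ps}) =
  replacePremises Starred (sym (forEach-trs refl As Ps)) &R
πILL⇒starred (&L {As = As} j∈I)
  rewrite sym (lookup-trs {t = ull} As j∈I) = &L j∈I
πILL⇒starred copy = copyL
πILL⇒starred !R = !R
πILL⇒starred !L = !L
πILL⇒starred (cutRL {Δ = Δ} {Δ′ = Δ′})
  rewrite map-++ (map₂ (tr {t = ull})) Δ Δ′ = cutRL {Λ = []}
πILL⇒starred (cutLR {Δ = Δ} {Δ′ = Δ′})
  -- Here `z ⦂ C` comes from the premise for `P`; the premise for `Q` offers only the cut name.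
  rewrite map-++ (map₂ (tr {t = ull})) Δ Δ′ = cutLR {Λ = _ ∷ []}
πILL⇒starred cut!R = cut!R
πILL⇒starred cut!L = cut!L

mutual
  -- For `↶` and `↷` the hypothesis contains an element of `⊥`, so only starred rules remain.
  restrict : (d : Derivation πULL↷ c) → EveryRule Neither↶nor↷ d → Derivation Starred c
  restrict (rule u (starred r) ds) (_ , p) = rule u r (restrictAll ds p)
  restrict (conv e d)              p       = conv e (restrict d p)

  restrictAll : (ds : All (Derivation πULL↷) ps) → EveryRules Neither↶nor↷ ds →
                All (Derivation Starred) ps
  restrictAll []       _       = []
  restrictAll (d ∷ ds) (p , q) = restrict d p ∷ restrictAll ds q

-- The equivalences

TypableILL : Proc → Set
TypableILL P = ∃[ Γ ] ∃[ Δ ] ∃[ x ] ∃[ A ] Derivation πILL (Γ ⨾ Δ ⊢ P :: x ⦂ A ∷ [])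

TypableDegree1 : Proc → Set
TypableDegree1 P = ∃[ Γ ] ∃[ Δ ] ∃[ Λ ] ∃[ d ]
  EverySequent {R = πULL} {c = Γ ⨾ Δ ⊢ P :: Λ} (λ s → r-degree s ≡ 1) d

TypableWithout↶↷ : Proc → Set
TypableWithout↶↷ P = ∃[ Γ ] ∃[ Δ ] ∃[ Λ ] ∃[ d ]
  EveryRule {R = πULL↷} {c = Γ ⨾ Δ ⊢ P :: Λ} Neither↶nor↷ d

-- A fourth condition linking the three: starred derivations embed in both πULL and πULL↷.
TypableStarred : Proc → Set
TypableStarred P = ∃[ Γ ] ∃[ Δ ] ∃[ Λ ] Derivation Starred (Γ ⨾ Δ ⊢ P :: Λ)

module _ {P : Proc} where

  ILL⇒starred : TypableILL P → TypableStarred P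
  ILL⇒starred (_ , _ , _ , _ , d) = _ , _ , _ ,
    translate (λ r _ _ → πILL⇒starred r) d
      -- Each rule of πILL translates unconditionally, so the trivial invariant suffices.
      (invariant {φ = λ _ → ⊤} (λ _ _ → tt) (λ _ _ → tt) d)

  starred⇒degree1 : TypableStarred P → TypableDegree1 P
  starred⇒degree1 (_ , _ , _ , d) = _ , _ , _ ,
    mapRules starred d , everySequent-mapRules starred d (starred-degree1 d)

  degree1⇒ILL : TypableDegree1 P → TypableILL P
  degree1⇒ILL (Γ , Δ , Λ , d , p)
    with degree1⇒singleton {c = Γ ⨾ Δ ⊢ P :: Λ}
           (conclusion {φ = λ s → r-degree s ≡ 1} {d = d} p)
  ... | [ _ ] = _ , _ , _ , _ ,
    translate (λ {_} {c} r ps p → πULL⇒πILL r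
      (All.map (λ {s} → degree1⇒singleton {c = s}) ps) (degree1⇒singleton {c = c} p)) d p

  starred⇒without↶↷ : TypableStarred P → TypableWithout↶↷ P
  starred⇒without↶↷ (_ , _ , _ , d) = _ , _ , _ ,
    mapRules starred d , everyRule-mapRules starred (λ _ → tt) d

  without↶↷⇒starred : TypableWithout↶↷ P → TypableStarred P
  without↶↷⇒starred (_ , _ , _ , d , p) = _ , _ , _ , restrict d p

mainTheorem7 : (P : Proc) →
    ((∃[ Γ ] ∃[ Δ ] ∃[ x ] ∃[ A ] Derivation πILL (Γ ⨾ Δ ⊢ P :: x ⦂ A ∷ []))
    ⇔
    (∃[ Γ ] ∃[ Δ ] ∃[ Λ ] ∃[ d ] EverySequent {R = πULL} {c = Γ ⨾ Δ ⊢ P :: Λ} (λ s → r-degree s ≡ 1) d))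
    ×
    ((∃[ Γ ] ∃[ Δ ] ∃[ Λ ] ∃[ d ] EverySequent {R = πULL} {c = Γ ⨾ Δ ⊢ P :: Λ} (λ s → r-degree s ≡ 1) d)
    ⇔
    (∃[ Γ ] ∃[ Δ ] ∃[ Λ ] ∃[ d ] EveryRule {R = πULL↷} {c = Γ ⨾ Δ ⊢ P :: Λ} Neither↶nor↷ d))
mainTheorem7 P =
    mk⇔ (starred⇒degree1 ∘ ILL⇒starred) degree1⇒ILL
  -- The detour through πILL may change the types; this is harmless because contexts are
  -- existentially quantified.
  , mk⇔ (starred⇒without↶↷ ∘ ILL⇒starred ∘ degree1⇒ILL)
        (starred⇒degree1 ∘ without↶↷⇒starred)
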